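{- Let $x$ be a positive integer and for $k\geq 1$ let $$F_k(x):=\left[x,\frac{1}{x},x^2,\frac{1}{x^2},x^3,\frac{1}{x^3},x^4,\frac{1}{x^4},\dots,x^k,\frac{1}{x^k}\right].$$ Then, as $k\to\infty$, $F_k(x)$ converges to a quadratic irrational that is the positive root (in $z$) of the polynomial $P(x,z)=z^2-(2x-1)z-x$.
   Context: For positive real numbers $b_0,b_1,\dots,b_n$, the notation $[b_0,b_1,\dots,b_n]$ denotes the finite continued fraction $b_0+\cfrac{1}{b_1+\cfrac{1}{b_2+\cdots+\cfrac{1}{b_n}}}$; the partial quotients need not be integers. Thus $F_k(x)$ has $2k$ partial quotients, alternating $x^i, 1/x^i$ for $i=1,\dots,k$. A quadratic irrational is an irrational real number that is a root of a quadratic polynomial with integer coefficients. -}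

module Defs where

open import Data.Integer.Base as ℤ using (ℤ; 0ℤ)
open import Data.List.Base using ([]; _∷_; applyUpTo)
open import Data.List.NonEmpty.Base as List⁺ using (List⁺; _∷_)
open import Data.Nat.Base as ℕ using (ℕ)
import Data.Nat.Properties as ℕₚ
open import Data.Product.Base using (∃; ∃-syntax; _×_; _,_; proj₁)
open import Data.Rational.Base
open import Data.Rational.Properties
open import Data.Rational.Solver using (module +-*-Solver)
open import Data.Sum.Base using (inj₁; inj₂)
open import Function.Base using (id; _∘_)
open import Relation.Binary.PropositionalEquality
  using (_≡_; _≢_; refl; sym; trans; cong; cong₂; subst)
open import Relation.Nullary.Negation.Core using (¬_)

private
  open +-*-Solver using (solve; _:+_; _:*_; _:-_; :-_; _:=_; con)

  ½*ε+½*ε≡ε : ∀ ε → ½ * ε + ½ * ε ≡ ε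
  ½*ε+½*ε≡ε = solve 1 (λ e → con ½ :* e :+ con ½ :* e := e) refl

  0<½*ε : ∀ {ε} → 0ℚ < ε → 0ℚ < ½ * ε
  0<½*ε {ε} 0<ε = subst (_< ½ * ε) (*-zeroʳ ½) (*-monoʳ-<-pos ½ 0<ε)

  ∣p∣≤q : ∀ {p q} → p ≤ q → - p ≤ q → ∣ p ∣ ≤ q
  ∣p∣≤q {p} p≤q -p≤q with ∣p∣≡p∨∣p∣≡-p p
  ... | inj₁ eq = subst (_≤ _) (sym eq) p≤q
  ... | inj₂ eq = subst (_≤ _) (sym eq) -p≤q

  ∣p∣-∣q∣≤∣p-q∣ : ∀ p q → ∣ p ∣ - ∣ q ∣ ≤ ∣ p - q ∣
  ∣p∣-∣q∣≤∣p-q∣ p q = begin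
    ∣ p ∣ - ∣ q ∣                ≡⟨ cong (λ r → ∣ r ∣ - ∣ q ∣) (lem₁ p q) ⟩
    ∣ p - q + q ∣ - ∣ q ∣        ≤⟨ +-monoˡ-≤ (- ∣ q ∣) (∣p+q∣≤∣p∣+∣q∣ (p - q) q) ⟩
    ∣ p - q ∣ + ∣ q ∣ - ∣ q ∣    ≡⟨ lem₂ ∣ p - q ∣ ∣ q ∣ ⟩
    ∣ p - q ∣                    ∎
    where
    open ≤-Reasoning
    lem₁ : ∀ a b → a ≡ a - b + b
    lem₁ = solve 2 (λ a b → a := a :- b :+ b) refl
    lem₂ : ∀ a b → a + b - b ≡ a
    lem₂ = solve 2 (λ a b → a :+ b :- b := a) refl

  ∣p-q∣≡∣q-p∣ : ∀ p q → ∣ p - q ∣ ≡ ∣ q - p ∣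
  ∣p-q∣≡∣q-p∣ p q = trans (sym (∣-p∣≡∣p∣ (p - q))) (cong ∣_∣ (lem p q))
    where
    lem : ∀ a b → - (a - b) ≡ b - a
    lem = solve 2 (λ a b → :- (a :- b) := b :- a) refl

  ∣∣p∣-∣q∣∣≤∣p-q∣ : ∀ p q → ∣ ∣ p ∣ - ∣ q ∣ ∣ ≤ ∣ p - q ∣
  ∣∣p∣-∣q∣∣≤∣p-q∣ p q = ∣p∣≤q (∣p∣-∣q∣≤∣p-q∣ p q) (begin
    - (∣ p ∣ - ∣ q ∣)  ≡⟨ lem ∣ p ∣ ∣ q ∣ ⟩
    ∣ q ∣ - ∣ p ∣      ≤⟨ ∣p∣-∣q∣≤∣p-q∣ q p ⟩
    ∣ q - p ∣          ≡⟨ ∣p-q∣≡∣q-p∣ q p ⟩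
    ∣ p - q ∣          ∎)
    where
    open ≤-Reasoning
    lem : ∀ a b → - (a - b) ≡ b - a
    lem = solve 2 (λ a b → :- (a :- b) := b :- a) refl

  ∣pr-qs∣≤ : ∀ p q r s → ∣ p * r - q * s ∣ ≤ ∣ p ∣ * ∣ r - s ∣ + ∣ s ∣ * ∣ p - q ∣
  ∣pr-qs∣≤ p q r s = begin
    ∣ p * r - q * s ∣                          ≡⟨ cong ∣_∣ (lem p q r s) ⟩
    ∣ p * (r - s) + s * (p - q) ∣              ≤⟨ ∣p+q∣≤∣p∣+∣q∣ (p * (r - s)) (s * (p - q)) ⟩
    ∣ p * (r - s) ∣ + ∣ s * (p - q) ∣          ≡⟨ cong (_+ ∣ s * (p - q) ∣) (∣p*q∣≡∣p∣*∣q∣ p (r - s)) ⟩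
    ∣ p ∣ * ∣ r - s ∣ + ∣ s * (p - q) ∣        ≡⟨ cong (∣ p ∣ * ∣ r - s ∣ +_) (∣p*q∣≡∣p∣*∣q∣ s (p - q)) ⟩
    ∣ p ∣ * ∣ r - s ∣ + ∣ s ∣ * ∣ p - q ∣      ∎
    where
    open ≤-Reasoning
    lem : ∀ a b c d → a * c - b * d ≡ a * (c - d) + d * (a - b)
    lem = solve 4 (λ a b c d → a :* c :- b :* d := a :* (c :- d) :+ d :* (a :- b)) refl

IsCauchy : (ℕ → ℚ) → Set
IsCauchy s = ∀ ε → 0ℚ < ε →
  ∃[ N ] ∀ m n → N ℕ.≤ m → N ℕ.≤ n → ∣ s m - s n ∣ < ε

-- A Cauchy sequence represents its limit; equality of reals is _≈ℝ_ below.
record ℝ : Set where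
  constructor mkℝ
  field
    seq    : ℕ → ℚ
    cauchy : IsCauchy seq

open ℝ public

infix 4 _≈ℝ_ _<ℝ_

_≈ℝ_ : ℝ → ℝ → Set
a ≈ℝ b = ∀ ε → 0ℚ < ε → ∃[ N ] ∀ n → N ℕ.≤ n → ∣ seq a n - seq b n ∣ < ε

-- The gap δ must be uniform: a termwise strict inequality between the
-- sequences would only bound the limits weakly.
_<ℝ_ : ℝ → ℝ → Set
a <ℝ b = ∃[ δ ] (0ℚ < δ × ∃[ N ] ∀ n → N ℕ.≤ n → seq a n + δ ≤ seq b n)

private
  const-cauchy : ∀ q → IsCauchy (λ _ → q)
  const-cauchy q ε 0<ε = 0 , λ _ _ _ _ → subst (_< ε) (sym (cong ∣_∣ (+-inverseʳ q))) 0<ε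

  +-cauchy : ∀ {s t} → IsCauchy s → IsCauchy t → IsCauchy (λ n → s n + t n)
  +-cauchy {s} {t} cs ct ε 0<ε
    with M , hs ← cs (½ * ε) (0<½*ε 0<ε)
       | N , ht ← ct (½ * ε) (0<½*ε 0<ε)
    = M ℕ.⊔ N , λ m n h k → begin-strict
      ∣ s m + t m - (s n + t n) ∣        ≡⟨ cong ∣_∣ (lem (s m) (t m) (s n) (t n)) ⟩
      ∣ (s m - s n) + (t m - t n) ∣      ≤⟨ ∣p+q∣≤∣p∣+∣q∣ (s m - s n) (t m - t n) ⟩
      ∣ s m - s n ∣ + ∣ t m - t n ∣      <⟨ +-mono-<
        (hs m n (ℕₚ.m⊔n≤o⇒m≤o M N h) (ℕₚ.m⊔n≤o⇒m≤o M N k))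
        (ht m n (ℕₚ.m⊔n≤o⇒n≤o M N h) (ℕₚ.m⊔n≤o⇒n≤o M N k)) ⟩
      ½ * ε + ½ * ε                      ≡⟨ ½*ε+½*ε≡ε ε ⟩
      ε                                  ∎
    where
    open ≤-Reasoning
    lem : ∀ a b c d → a + b - (c + d) ≡ (a - c) + (b - d)
    lem = solve 4 (λ a b c d → a :+ b :- (c :+ d) := (a :- c) :+ (b :- d)) refl

  neg-cauchy : ∀ {s} → IsCauchy s → IsCauchy (-_ ∘ s)
  neg-cauchy {s} cs ε 0<ε with N , hs ← cs ε 0<ε
    = N , λ m n h k → subst (_< ε) (lem m n) (hs m n h k)
    where
    lem′ : ∀ a b → - (a - b) ≡ - a - - b
    lem′ = solve 2 (λ a b → :- (a :- b) := :- a :- :- b) refl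
    lem : ∀ m n → ∣ s m - s n ∣ ≡ ∣ - s m - - s n ∣
    lem m n = trans (sym (∣-p∣≡∣p∣ (s m - s n))) (cong ∣_∣ (lem′ (s m) (s n)))

  abs-cauchy : ∀ {s} → IsCauchy s → IsCauchy (∣_∣ ∘ s)
  abs-cauchy {s} cs ε 0<ε with N , hs ← cs ε 0<ε
    = N , λ m n h k → ≤-<-trans (∣∣p∣-∣q∣∣≤∣p-q∣ (s m) (s n)) (hs m n h k)

  eventually-bounded : ∀ {s} → IsCauchy s →
    ∃[ B ] (0ℚ < B × ∃[ N ] ∀ n → N ℕ.≤ n → ∣ s n ∣ ≤ B)
  eventually-bounded {s} cs with N , hs ← cs 1ℚ (positive⁻¹ 1ℚ)
    = 1ℚ + ∣ s N ∣
    , +-mono-<-≤ (positive⁻¹ 1ℚ) (0≤∣p∣ (s N))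
    , N
    , λ n h → begin
      ∣ s n ∣                      ≡⟨ cong ∣_∣ (lem (s n) (s N)) ⟩
      ∣ (s n - s N) + s N ∣        ≤⟨ ∣p+q∣≤∣p∣+∣q∣ (s n - s N) (s N) ⟩
      ∣ s n - s N ∣ + ∣ s N ∣      ≤⟨ +-monoˡ-≤ ∣ s N ∣ (<⇒≤ (hs n N h ℕₚ.≤-refl)) ⟩
      1ℚ + ∣ s N ∣                 ∎
    where
    open ≤-Reasoning
    lem : ∀ a b → a ≡ (a - b) + b
    lem = solve 2 (λ a b → a := (a :- b) :+ b) refl

  -- B * δ ≤ ε is attained with δ = (1/B) * ε.
  scaled : ∀ {B ε} → 0ℚ < B → 0ℚ < ε → ∃[ δ ] (0ℚ < δ × B * δ ≡ ε)
  scaled {B} {ε} 0<B 0<ε = 1/ B * ε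
    , subst (_< 1/ B * ε) (*-zeroʳ (1/ B)) (*-monoʳ-<-pos (1/ B) 0<ε)
    , trans (sym (*-assoc B (1/ B) ε)) (trans (cong (_* ε) (*-inverseʳ B)) (*-identityˡ ε))
    where
    instance
      B-pos : Positive B
      B-pos = positive 0<B
      B-nonZero : _
      B-nonZero = pos⇒nonZero B
      1/B-pos : Positive (1/ B)
      1/B-pos = 1/pos⇒pos B

  *-<-bound : ∀ p q {C δ} → 0ℚ < C → ∣ p ∣ ≤ C → ∣ q ∣ < δ → ∣ p ∣ * ∣ q ∣ < C * δ
  *-<-bound p q {C} 0<C p≤C q<δ = ≤-<-trans
    (*-monoʳ-≤-nonNeg ∣ q ∣ {{∣-∣-nonNeg q}} p≤C)
    (*-monoʳ-<-pos C {{positive 0<C}} q<δ)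

  ∣pr-qs∣< : ∀ p q r s {A B α β ε} → 0ℚ < A → 0ℚ < B →
    A * α ≡ ½ * ε → B * β ≡ ½ * ε →
    ∣ p ∣ ≤ A → ∣ s ∣ ≤ B → ∣ r - s ∣ < α → ∣ p - q ∣ < β →
    ∣ p * r - q * s ∣ < ε
  ∣pr-qs∣< p q r s {A} {B} {α} {β} {ε} 0<A 0<B Aα≡ Bβ≡ p≤A s≤B r-s<α p-q<β = begin-strict
    ∣ p * r - q * s ∣                        ≤⟨ ∣pr-qs∣≤ p q r s ⟩
    ∣ p ∣ * ∣ r - s ∣ + ∣ s ∣ * ∣ p - q ∣    <⟨ +-mono-< (*-<-bound p (r - s) 0<A p≤A r-s<α)
                                                         (*-<-bound s (p - q) 0<B s≤B p-q<β) ⟩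
    A * α + B * β                            ≡⟨ cong₂ _+_ Aα≡ Bβ≡ ⟩
    ½ * ε + ½ * ε                            ≡⟨ ½*ε+½*ε≡ε ε ⟩
    ε                                        ∎
    where open ≤-Reasoning

  *-cauchy : ∀ {s t} → IsCauchy s → IsCauchy t → IsCauchy (λ n → s n * t n)
  *-cauchy {s} {t} cs ct ε 0<ε =
    let A , 0<A , K , bs = eventually-bounded cs
        B , 0<B , L , bt = eventually-bounded ct
        α , 0<α , Aα≡    = scaled 0<A (0<½*ε 0<ε)
        β , 0<β , Bβ≡    = scaled 0<B (0<½*ε 0<ε)
        M , hs           = cs β 0<β
        N , ht           = ct α 0<α
    in (K ℕ.⊔ L) ℕ.⊔ (M ℕ.⊔ N) , λ m n h k →
      let h₁ = ℕₚ.m⊔n≤o⇒m≤o (K ℕ.⊔ L) (M ℕ.⊔ N) h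
          h₂ = ℕₚ.m⊔n≤o⇒n≤o (K ℕ.⊔ L) (M ℕ.⊔ N) h
          k₁ = ℕₚ.m⊔n≤o⇒m≤o (K ℕ.⊔ L) (M ℕ.⊔ N) k
          k₂ = ℕₚ.m⊔n≤o⇒n≤o (K ℕ.⊔ L) (M ℕ.⊔ N) k
      in ∣pr-qs∣< (s m) (s n) (t m) (t n) 0<A 0<B Aα≡ Bβ≡
           (bs m (ℕₚ.m⊔n≤o⇒m≤o K L h₁))
           (bt n (ℕₚ.m⊔n≤o⇒n≤o K L k₁))
           (ht m n (ℕₚ.m⊔n≤o⇒n≤o M N h₂) (ℕₚ.m⊔n≤o⇒n≤o M N k₂))
           (hs m n (ℕₚ.m⊔n≤o⇒m≤o M N h₂) (ℕₚ.m⊔n≤o⇒m≤o M N k₂))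

infixl 7 _*ℝ_
infixl 6 _+ℝ_ _-ℝ_
infix  8 -ℝ_

fromℚ : ℚ → ℝ
fromℚ q = mkℝ (λ _ → q) (const-cauchy q)

fromℤ : ℤ → ℝ
fromℤ i = fromℚ (i / 1)

fromℕ : ℕ → ℝ
fromℕ n = fromℤ (ℤ.+ n)

_+ℝ_ : ℝ → ℝ → ℝ
a +ℝ b = mkℝ (λ n → seq a n + seq b n) (+-cauchy {seq a} {seq b} (cauchy a) (cauchy b))

-ℝ_ : ℝ → ℝ
-ℝ a = mkℝ (λ n → - seq a n) (neg-cauchy {seq a} (cauchy a))

_-ℝ_ : ℝ → ℝ → ℝ
a -ℝ b = a +ℝ (-ℝ b)

_*ℝ_ : ℝ → ℝ → ℝ
a *ℝ b = mkℝ (λ n → seq a n * seq b n) (*-cauchy {seq a} {seq b} (cauchy a) (cauchy b))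

∣_∣ℝ : ℝ → ℝ
∣ a ∣ℝ = mkℝ (λ n → ∣ seq a n ∣) (abs-cauchy {seq a} (cauchy a))

ConvergesTo : (ℕ → ℝ) → ℝ → Set
ConvergesTo u l = ∀ ε → fromℕ 0 <ℝ ε →
  ∃[ N ] ∀ n → N ℕ.≤ n → ∣ u n -ℝ l ∣ℝ <ℝ ε

Irrational : ℝ → Set
Irrational z = ¬ (∃[ q ] z ≈ℝ fromℚ q)

QuadraticIrrational : ℝ → Set
QuadraticIrrational z = Irrational z ×
  ∃[ a ] ∃[ b ] ∃[ c ]
    (a ≢ 0ℤ × fromℤ a *ℝ (z *ℝ z) +ℝ fromℤ b *ℝ z +ℝ fromℤ c ≈ℝ fromℕ 0)

-- Partial quotients may be any positive rationals; positivity makes every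
-- denominator in a continued fraction nonzero.
ℚ⁺ : Set
ℚ⁺ = ∃ Positive

infixl 6 _+⁺_
infix  8 1/⁺_

_+⁺_ : ℚ⁺ → ℚ⁺ → ℚ⁺
(p , p>0) +⁺ (q , q>0) = p + q , pos+pos⇒pos p {{p>0}} q {{q>0}}

1/⁺_ : ℚ⁺ → ℚ⁺
1/⁺ (p , p>0) = (1/ p) {{pos⇒nonZero p {{p>0}}}} , 1/pos⇒pos p {{p>0}}

-- [b₀, b₁, …, bₙ] = b₀ + 1/[b₁, …, bₙ]
continuedFraction : List⁺ ℚ⁺ → ℚ⁺
continuedFraction = List⁺.foldr (λ b t → b +⁺ 1/⁺ t) id

power⁺ : (x i : ℕ) .{{_ : ℕ.NonZero x}} → ℚ⁺
power⁺ x i = ℤ.+ (x ℕ.^ i) / 1 , normalize-pos (x ℕ.^ i) 1 {{_}} {{ℕₚ.m^n≢0 x i}}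

-- The exponents 1, 2, …, k, for k ≥ 1.
oneTo : (k : ℕ) .{{_ : ℕ.NonZero k}} → List⁺ ℕ
oneTo k = 1 ∷ applyUpTo (2 ℕ.+_) (ℕ.pred k)

F : (k x : ℕ) .{{_ : ℕ.NonZero k}} .{{_ : ℕ.NonZero x}} → ℚ⁺
F k x = continuedFraction
  (List⁺.concatMap (λ i → power⁺ x i ∷ 1/⁺ power⁺ x i ∷ []) (oneTo k))

P : ℕ → ℝ → ℝ
P x z = z *ℝ z -ℝ (fromℕ 2 *ℝ fromℕ x -ℝ fromℕ 1) *ℝ z -ℝ fromℕ x

{-# OPTIONS --safe #-}

-- Let T h = x (2h + 1) / (h + 1) = [x, 1/x, x h].  Pulling the factor xᵉ out of the part
-- of the continued fraction that starts at exponent e + 1 gives F_k(x) = T^(k-1)(2x).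
-- Since T h − T h′ = x (h − h′) / ((h + 1)(h′ + 1)), the map T contracts [x, ∞) by the
-- factor 1/2, and its fixed points are the roots of P(x, z).  The limit z satisfies
-- z ≥ 2x − 1, and P w − P z = (w − z)(w + z − (2x − 1)), so no other positive w is a root.
-- A rational fixed point a/b in lowest terms would satisfy a (a + b) = x b (2a + b); as
-- 2a + b is coprime to a, it would divide the smaller number a + b.
module Submission where

open import Defs
open import Data.Nat.Base using (ℕ; suc; NonZero)
open import Data.Product.Base using (∃-syntax; _×_; proj₁)
open import Data.Integer.Base as ℤ using (1ℤ)
import Data.Integer.Properties as ℤₚ
open import Data.List.Base using ([]; _∷_; applyUpTo)
open import Data.List.NonEmpty.Base as List⁺ using (List⁺; _∷_)
open import Data.Nat.Base as ℕ using (zero)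
open import Data.Nat.Coprimality as Coprime using (Coprime; coprime-divisor; coprime-+)
open import Data.Nat.Divisibility using (divides; ∣⇒≤)
import Data.Nat.Properties as ℕₚ
open import Data.Product.Base using (_,_; proj₂)
open import Data.Rational.Base hiding (NonZero)
open import Data.Rational.Properties
open import Data.Rational.Solver using (module +-*-Solver)
import Data.Rational.Unnormalised.Base as ℚᵘ
open import Data.Rational.Unnormalised.Properties using (≃-setoid)
open import Data.Sum.Base using (inj₁; inj₂)
open import Function.Base using (_∘_)
open import Relation.Binary.PropositionalEquality
  using (_≡_; _≢_; refl; sym; trans; cong; cong₂; subst; subst₂; module ≡-Reasoning)
import Relation.Binary.Reasoning.Setoid as ≈-Reasoning
open import Relation.Nullary.Negation.Core using (¬_)

open +-*-Solver using (solve; _:+_; _:*_; _:-_; :-_; _:=_; con)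

-- Integers embedded in the rationals.

-- Division normalises by a gcd that is stuck on a variable `i`. Rewriting to the constructor form
-- exposes numerator and denominator, so that the arithmetic on `i / 1` computes.
/1-mkℚ : ∀ i → i / 1 ≡ mkℚ i 0 (Coprime.sym (Coprime.1-coprimeTo ℤ.∣ i ∣))
/1-mkℚ i = ↥p/↧p≡p (mkℚ i 0 (Coprime.sym (Coprime.1-coprimeTo ℤ.∣ i ∣)))

/1-injective : ∀ {i j} → i / 1 ≡ j / 1 → i ≡ j
/1-injective {i} {j} eq = cong ↥_ (trans (sym (/1-mkℚ i)) (trans eq (/1-mkℚ j)))

/1-homo-+ : ∀ i j → (i ℤ.+ j) / 1 ≡ i / 1 + j / 1
/1-homo-+ i j rewrite /1-mkℚ i | /1-mkℚ j =
  cong (_/ 1) (sym (cong₂ ℤ._+_ (ℤₚ.*-identityʳ i) (ℤₚ.*-identityʳ j)))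

/1-homo-* : ∀ i j → (i ℤ.* j) / 1 ≡ (i / 1) * (j / 1)
/1-homo-* i j rewrite /1-mkℚ i | /1-mkℚ j = refl

ι : ℕ → ℚ
ι n = (ℤ.+ n) / 1

ι-homo-* : ∀ m n → ι (m ℕ.* n) ≡ ι m * ι n
ι-homo-* m n = trans (cong (_/ 1) (ℤₚ.pos-* m n)) (/1-homo-* (ℤ.+ m) (ℤ.+ n))

ι-homo-+ : ∀ m n → ι (m ℕ.+ n) ≡ ι m + ι n
ι-homo-+ m n = /1-homo-+ (ℤ.+ m) (ℤ.+ n)

ι-injective : ∀ {m n} → ι m ≡ ι n → m ≡ n
ι-injective eq = ℤₚ.+-injective (/1-injective eq)

/1-homo‿- : ∀ i → (ℤ.- i) / 1 ≡ - (i / 1)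
/1-homo‿- i = begin
  (ℤ.- i) / 1                          ≡⟨ lem ((ℤ.- i) / 1) (i / 1) ⟩
  ((ℤ.- i) / 1 + i / 1) - i / 1        ≡⟨ cong (_- i / 1) (/1-homo-+ (ℤ.- i) i) ⟨
  (ℤ.- i ℤ.+ i) / 1 - i / 1            ≡⟨ cong (λ j → j / 1 - i / 1) (ℤₚ.+-inverseˡ i) ⟩
  0ℚ - i / 1                           ≡⟨ +-identityˡ (- (i / 1)) ⟩
  - (i / 1)                            ∎
  where
  open ≡-Reasoning
  lem : ∀ a b → a ≡ a + b - b
  lem = solve 2 (λ a b → a := a :+ b :- b) refl

/1-mono-≤ : ∀ {i j} → i ℤ.≤ j → i / 1 ≤ j / 1
/1-mono-≤ {i} {j} i≤j rewrite /1-mkℚ i | /1-mkℚ j =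
  *≤* (subst₂ ℤ._≤_ (sym (ℤₚ.*-identityʳ i)) (sym (ℤₚ.*-identityʳ j)) i≤j)

p*↧p≡↥p : ∀ p → p * (↧ p / 1) ≡ ↥ p / 1
p*↧p≡↥p p@(mkℚ _ _ _) = trans (cong (p *_) (/1-mkℚ (↧ p))) (toℚᵘ-injective (begin
  toℚᵘ (p * n)            ≈⟨ toℚᵘ-homo-* p n ⟩
  toℚᵘ p ℚᵘ.* toℚᵘ n      ≈⟨ ℚᵘ.*≡* (trans (ℤₚ.*-identityʳ _)
                                            (cong (λ d → ↥ p ℤ.* ℤ.+ d) (sym (ℕₚ.*-identityʳ (↧ₙ p))))) ⟩
  ℚᵘ.mkℚᵘ (↥ p) 0         ≡⟨ cong toℚᵘ (/1-mkℚ (↥ p)) ⟨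
  toℚᵘ (↥ p / 1)          ∎))
  where
  n = mkℚ (↧ p) 0 (Coprime.sym (Coprime.1-coprimeTo (↧ₙ p)))
  open ≈-Reasoning ≃-setoid

-- Order, absolute value and the Archimedean property of the rationals.

*-cancelʳ-≡-pos : ∀ {p q} r .{{_ : Positive r}} → p * r ≡ q * r → p ≡ q
*-cancelʳ-≡-pos r eq = ≤-antisym
  (*-cancelʳ-≤-pos r (≤-reflexive eq)) (*-cancelʳ-≤-pos r (≤-reflexive (sym eq)))

p≤p+q : ∀ p {q} → 0ℚ ≤ q → p ≤ p + q
p≤p+q p 0≤q = subst (_≤ p + _) (+-identityʳ p) (+-monoʳ-≤ p 0≤q)

p+q≤p : ∀ p {q} → q ≤ 0ℚ → p + q ≤ p
p+q≤p p q≤0 = subst (p + _ ≤_) (+-identityʳ p) (+-monoʳ-≤ p q≤0)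

0≤q-p : ∀ {p q} → p ≤ q → 0ℚ ≤ q - p
0≤q-p {p} {q} p≤q = subst (_≤ q - p) (+-inverseʳ p) (+-monoˡ-≤ (- p) p≤q)

*-nonNeg : ∀ {p q} → 0ℚ ≤ p → 0ℚ ≤ q → 0ℚ ≤ p * q
*-nonNeg {p} {q} 0≤p 0≤q = subst (_≤ p * q) (*-zeroʳ p)
  (*-monoˡ-≤-nonNeg p {{nonNegative 0≤p}} 0≤q)

*-pos : ∀ {p q} → 0ℚ < p → 0ℚ < q → 0ℚ < p * q
*-pos {p} {q} 0<p 0<q = subst (_< p * q) (*-zeroʳ p) (*-monoʳ-<-pos p {{positive 0<p}} 0<q)

∣p-q∣-comm : ∀ p q → ∣ p - q ∣ ≡ ∣ q - p ∣
∣p-q∣-comm p q = trans (sym (∣-p∣≡∣p∣ (p - q))) (cong ∣_∣ (lem p q))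
  where
  lem : ∀ a b → - (a - b) ≡ b - a
  lem = solve 2 (λ a b → :- (a :- b) := b :- a) refl

∣p-r∣≤ : ∀ p q r → ∣ p - r ∣ ≤ ∣ p - q ∣ + ∣ q - r ∣
∣p-r∣≤ p q r = subst (λ d → ∣ d ∣ ≤ ∣ p - q ∣ + ∣ q - r ∣) (lem p q r) (∣p+q∣≤∣p∣+∣q∣ (p - q) (q - r))
  where
  lem : ∀ a b c → (a - b) + (b - c) ≡ a - c
  lem = solve 3 (λ a b c → (a :- b) :+ (b :- c) := a :- c) refl

∣p-q∣≤-within : ∀ {a c p q} → a ≤ p → p ≤ a + c → a ≤ q → q ≤ a + c → ∣ p - q ∣ ≤ c
∣p-q∣≤-within {a} {c} {p} {q} a≤p p≤ a≤q q≤ with ∣p∣≡p∨∣p∣≡-p (p - q)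
... | inj₁ eq = subst (_≤ c) (sym eq) (subst (p - q ≤_) (lem a c) (+-mono-≤ p≤ (neg-antimono-≤ a≤q)))
  where
  lem : ∀ a c → a + c - a ≡ c
  lem = solve 2 (λ a c → a :+ c :- a := c) refl
... | inj₂ eq = subst (_≤ c) (sym (trans eq (lem p q))) (subst (q - p ≤_) (lem′ a c) (+-mono-≤ q≤ (neg-antimono-≤ a≤p)))
  where
  lem : ∀ a b → - (a - b) ≡ b - a
  lem = solve 2 (λ a b → :- (a :- b) := b :- a) refl
  lem′ : ∀ a c → a + c - a ≡ c
  lem′ = solve 2 (λ a c → a :+ c :- a := c) refl

½p+½p≡p : ∀ p → ½ * p + ½ * p ≡ p
½p+½p≡p = solve 1 (λ e → con ½ :* e :+ con ½ :* e := e) refl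

½-pos : ∀ {p} → 0ℚ < p → 0ℚ < ½ * p
½-pos = *-pos (positive⁻¹ ½)

-- With ε = (n + 1) / d, m ≤ m (n + 1) = m d ε < (1 + m d) ε, so N = m d serves.
archimedean : ∀ m {ε} → 0ℚ < ε → ∃[ N ] (ι m < ι (suc N) * ε)
archimedean m {ε@(mkℚ ℤ.+[1+ n ] d-1 _)} 0<ε = m ℕ.* d , (begin-strict
  ι m                                    ≤⟨ /1-mono-≤ (ℤ.+≤+ (ℕₚ.m≤m*n m (suc n))) ⟩
  ι (m ℕ.* suc n)                        ≡⟨ ι-homo-* m (suc n) ⟩
  ι m * ι (suc n)                        ≡⟨ cong (ι m *_) (p*↧p≡↥p ε) ⟨
  ι m * (ε * ι d)                        ≡⟨ +-identityˡ _ ⟨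
  0ℚ + ι m * (ε * ι d)                   <⟨ +-monoˡ-< (ι m * (ε * ι d)) 0<ε ⟩
  ε + ι m * (ε * ι d)                    ≡⟨ lem ε (ι m) (ι d) ⟩
  (1ℚ + ι m * ι d) * ε                   ≡⟨ cong (λ p → (1ℚ + p) * ε) (ι-homo-* m d) ⟨
  (1ℚ + ι (m ℕ.* d)) * ε                 ≡⟨ cong (_* ε) (ι-homo-+ 1 (m ℕ.* d)) ⟨
  ι (suc (m ℕ.* d)) * ε                  ∎)
  where
  open ≤-Reasoning
  d = suc d-1
  lem : ∀ e m d → e + m * (e * d) ≡ (1ℚ + m * d) * e
  lem = solve 3 (λ e m d → e :+ m :* (e :* d) := (con 1ℚ :+ m :* d) :* e) refl
archimedean m {mkℚ ℤ.+0 _ _} (*<* (ℤ.+<+ ()))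
archimedean m {mkℚ ℤ.-[1+ _ ] _ _} (*<* ())

-- The map T as a relation: bounds, contraction, and the value of P after one step.

-- For h ≠ -1, t = T h with the denominator cleared.
Step : ℚ → ℚ → ℚ → Set
Step X h t = t * (h + 1ℚ) ≡ X * (h + h + 1ℚ)

-- The constants are spelled `ι 2` and `ι 1` so that the terms of `P x z` are values of `poly (ι x)`
-- by definition.
poly : ℚ → ℚ → ℚ
poly X z = z * z - (ι 2 * X - ι 1) * z - X

+1-pos : ∀ {h} → 0ℚ ≤ h → Positive (h + 1ℚ)
+1-pos 0≤h = positive (+-mono-≤-< 0≤h (positive⁻¹ 1ℚ))

module _ {X : ℚ} (1≤X : 1ℚ ≤ X) where
  private
    0≤X : 0ℚ ≤ X
    0≤X = ≤-trans (nonNegative⁻¹ 1ℚ) 1≤X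

    instance
      X-nonNeg : NonNegative X
      X-nonNeg = nonNegative 0≤X
      X-pos : Positive X
      X-pos = positive (<-≤-trans (positive⁻¹ 1ℚ) 1≤X)

  step≥X : ∀ {h t} → 0ℚ ≤ h → Step X h t → X ≤ t
  step≥X {h} {t} 0≤h st = *-cancelʳ-≤-pos (h + 1ℚ) {{+1-pos 0≤h}} (begin
    X * (h + 1ℚ)        ≤⟨ *-monoˡ-≤-nonNeg X (p≤p+q (h + 1ℚ) 0≤h) ⟩
    X * (h + 1ℚ + h)    ≡⟨ lem X h ⟩
    X * (h + h + 1ℚ)    ≡⟨ st ⟨
    t * (h + 1ℚ)        ∎)
    where
    open ≤-Reasoning
    lem : ∀ X h → X * (h + 1ℚ + h) ≡ X * (h + h + 1ℚ)
    lem = solve 2 (λ X h → X :* (h :+ con 1ℚ :+ h) := X :* (h :+ h :+ con 1ℚ)) refl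

  step≤2X : ∀ {h t} → 0ℚ ≤ h → Step X h t → t ≤ X + X
  step≤2X {h} {t} 0≤h st = *-cancelʳ-≤-pos (h + 1ℚ) {{+1-pos 0≤h}} (begin
    t * (h + 1ℚ)            ≡⟨ st ⟩
    X * (h + h + 1ℚ)        ≤⟨ p≤p+q (X * (h + h + 1ℚ)) 0≤X ⟩
    X * (h + h + 1ℚ) + X    ≡⟨ lem X h ⟩
    (X + X) * (h + 1ℚ)      ∎)
    where
    open ≤-Reasoning
    lem : ∀ X h → X * (h + h + 1ℚ) + X ≡ (X + X) * (h + 1ℚ)
    lem = solve 2 (λ X h → X :* (h :+ h :+ con 1ℚ) :+ X := (X :+ X) :* (h :+ con 1ℚ)) refl

  -- The difference X (2h + 1) - (2X - 1)(h + 1) equals h + 1 - X. This sharper lower bound is what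
  -- uniqueness of the positive root rests on.
  step≥2X-1 : ∀ {h t} → X ≤ h → Step X h t → X + X - 1ℚ ≤ t
  step≥2X-1 {h} {t} X≤h st = *-cancelʳ-≤-pos (h + 1ℚ) {{+1-pos (≤-trans 0≤X X≤h)}} (begin
    (X + X - 1ℚ) * (h + 1ℚ)                              ≤⟨ p≤p+q _ (0≤q-p (≤-trans X≤h (p≤p+q h (nonNegative⁻¹ 1ℚ)))) ⟩
    (X + X - 1ℚ) * (h + 1ℚ) + (h + 1ℚ - X)               ≡⟨ lem X h ⟩
    X * (h + h + 1ℚ)                                     ≡⟨ st ⟨
    t * (h + 1ℚ)                                         ∎)
    where
    open ≤-Reasoning
    lem : ∀ X h → (X + X - 1ℚ) * (h + 1ℚ) + (h + 1ℚ - X) ≡ X * (h + h + 1ℚ)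
    lem = solve 2 (λ X h → (X :+ X :- con 1ℚ) :* (h :+ con 1ℚ) :+ (h :+ con 1ℚ :- X)
                      := X :* (h :+ h :+ con 1ℚ)) refl

  -- Clearing denominators gives (h + 1)(h′ + 1)(t - t′) = X (h - h′), and the product on the left
  -- is at least 2X because h + 1 ≥ X and h′ + 1 ≥ 2. Doubling the left side of the bound avoids a
  -- factor 1/2.
  step-contracts : ∀ {h t h′ t′} → X ≤ h → X ≤ h′ → Step X h t → Step X h′ t′ →
    ∣ t - t′ ∣ + ∣ t - t′ ∣ ≤ ∣ h - h′ ∣
  step-contracts {h} {t} {h′} {t′} X≤h X≤h′ st st′ = *-cancelˡ-≤-pos X (begin
    X * (d + d)                             ≡⟨ lem₁ X d ⟩
    X * (1ℚ + 1ℚ) * d                       ≤⟨ *-monoʳ-≤-nonNeg d {{∣-∣-nonNeg (t - t′)}} X2≤ ⟩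
    (h + 1ℚ) * (h′ + 1ℚ) * d                ≡⟨ cong (_* d) (0≤p⇒∣p∣≡p (*-nonNeg 0≤h+1 0≤h′+1)) ⟨
    ∣ (h + 1ℚ) * (h′ + 1ℚ) ∣ * d            ≡⟨ ∣p*q∣≡∣p∣*∣q∣ ((h + 1ℚ) * (h′ + 1ℚ)) (t - t′) ⟨
    ∣ (h + 1ℚ) * (h′ + 1ℚ) * (t - t′) ∣     ≡⟨ cong ∣_∣ difference ⟩
    ∣ X * (h - h′) ∣                        ≡⟨ ∣p*q∣≡∣p∣*∣q∣ X (h - h′) ⟩
    ∣ X ∣ * ∣ h - h′ ∣                      ≡⟨ cong (_* ∣ h - h′ ∣) (0≤p⇒∣p∣≡p 0≤X) ⟩
    X * ∣ h - h′ ∣                          ∎)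
    where
    open ≤-Reasoning
    d = ∣ t - t′ ∣
    0≤h+1 : 0ℚ ≤ h + 1ℚ
    0≤h+1 = +-mono-≤ (≤-trans 0≤X X≤h) (nonNegative⁻¹ 1ℚ)
    0≤h′+1 : 0ℚ ≤ h′ + 1ℚ
    0≤h′+1 = +-mono-≤ (≤-trans 0≤X X≤h′) (nonNegative⁻¹ 1ℚ)
    lem₁ : ∀ X d → X * (d + d) ≡ X * (1ℚ + 1ℚ) * d
    lem₁ = solve 2 (λ X d → X :* (d :+ d) := X :* (con 1ℚ :+ con 1ℚ) :* d) refl
    X2≤ : X * (1ℚ + 1ℚ) ≤ (h + 1ℚ) * (h′ + 1ℚ)
    X2≤ = ≤-trans
      (*-monoˡ-≤-nonNeg X (+-monoˡ-≤ 1ℚ (≤-trans 1≤X X≤h′)))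
      (*-monoʳ-≤-nonNeg (h′ + 1ℚ) {{nonNegative 0≤h′+1}}
        (≤-trans X≤h (p≤p+q h (nonNegative⁻¹ 1ℚ))))
    lem₂ : ∀ h t h′ t′ → (h + 1ℚ) * (h′ + 1ℚ) * (t - t′)
      ≡ (t * (h + 1ℚ)) * (h′ + 1ℚ) - (t′ * (h′ + 1ℚ)) * (h + 1ℚ)
    lem₂ = solve 4 (λ h t h′ t′ → (h :+ con 1ℚ) :* (h′ :+ con 1ℚ) :* (t :- t′)
      := (t :* (h :+ con 1ℚ)) :* (h′ :+ con 1ℚ) :- (t′ :* (h′ :+ con 1ℚ)) :* (h :+ con 1ℚ)) refl
    lem₃ : ∀ X h h′ → (X * (h + h + 1ℚ)) * (h′ + 1ℚ) - (X * (h′ + h′ + 1ℚ)) * (h + 1ℚ) ≡ X * (h - h′)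
    lem₃ = solve 3 (λ X h h′ → (X :* (h :+ h :+ con 1ℚ)) :* (h′ :+ con 1ℚ)
      :- (X :* (h′ :+ h′ :+ con 1ℚ)) :* (h :+ con 1ℚ) := X :* (h :- h′)) refl
    difference : (h + 1ℚ) * (h′ + 1ℚ) * (t - t′) ≡ X * (h - h′)
    difference = trans (lem₂ h t h′ t′) (trans
      (cong₂ (λ u v → u * (h′ + 1ℚ) - v * (h + 1ℚ)) st st′) (lem₃ X h h′))

  -- The identity (h + 1) P(t) = X (h - t) holds along a step, and X ≤ h + 1. Thus P is small
  -- wherever consecutive iterates are close.
  ∣poly∣≤step : ∀ {h t} → X ≤ h → Step X h t → ∣ poly X t ∣ ≤ ∣ h - t ∣
  ∣poly∣≤step {h} {t} X≤h st = *-cancelˡ-≤-pos (h + 1ℚ) {{+1-pos 0≤h}} (begin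
    (h + 1ℚ) * ∣ poly X t ∣       ≡⟨ cong (_* ∣ poly X t ∣) (0≤p⇒∣p∣≡p (+-mono-≤ 0≤h (nonNegative⁻¹ 1ℚ))) ⟨
    ∣ h + 1ℚ ∣ * ∣ poly X t ∣     ≡⟨ ∣p*q∣≡∣p∣*∣q∣ (h + 1ℚ) (poly X t) ⟨
    ∣ (h + 1ℚ) * poly X t ∣       ≡⟨ cong ∣_∣ value ⟩
    ∣ X * (h - t) ∣               ≡⟨ ∣p*q∣≡∣p∣*∣q∣ X (h - t) ⟩
    ∣ X ∣ * ∣ h - t ∣             ≡⟨ cong (_* ∣ h - t ∣) (0≤p⇒∣p∣≡p 0≤X) ⟩
    X * ∣ h - t ∣                 ≤⟨ *-monoʳ-≤-nonNeg ∣ h - t ∣ {{∣-∣-nonNeg (h - t)}}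
                                       (≤-trans X≤h (p≤p+q h (nonNegative⁻¹ 1ℚ))) ⟩
    (h + 1ℚ) * ∣ h - t ∣          ∎)
    where
    0≤h : 0ℚ ≤ h
    0≤h = ≤-trans 0≤X X≤h
    lem₁ : ∀ X h t → (h + 1ℚ) * poly X t
      ≡ (t + 1ℚ - ι 2 * X) * (t * (h + 1ℚ)) - X * (h + 1ℚ)
    lem₁ = solve 3 (λ X h t → (h :+ con 1ℚ) :* (t :* t :- (con (ι 2) :* X :- con (ι 1)) :* t :- X)
      := (t :+ con 1ℚ :- con (ι 2) :* X) :* (t :* (h :+ con 1ℚ)) :- X :* (h :+ con 1ℚ)) refl
    lem₂ : ∀ X h t → (t + 1ℚ - ι 2 * X) * (X * (h + h + 1ℚ)) - X * (h + 1ℚ)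
      ≡ X * ((h + h + 1ℚ) * t + h) - ι 2 * X * (X * (h + h + 1ℚ))
    lem₂ = solve 3 (λ X h t → (t :+ con 1ℚ :- con (ι 2) :* X) :* (X :* (h :+ h :+ con 1ℚ)) :- X :* (h :+ con 1ℚ)
      := X :* ((h :+ h :+ con 1ℚ) :* t :+ h) :- con (ι 2) :* X :* (X :* (h :+ h :+ con 1ℚ))) refl
    lem₃ : ∀ X h t → X * ((h + h + 1ℚ) * t + h) - ι 2 * X * (t * (h + 1ℚ)) ≡ X * (h - t)
    lem₃ = solve 3 (λ X h t → X :* ((h :+ h :+ con 1ℚ) :* t :+ h) :- con (ι 2) :* X :* (t :* (h :+ con 1ℚ))
      := X :* (h :- t)) refl
    value : (h + 1ℚ) * poly X t ≡ X * (h - t)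
    value = ≡.begin
      (h + 1ℚ) * poly X t                                           ≡.≡⟨ lem₁ X h t ⟩
      (t + 1ℚ - ι 2 * X) * (t * (h + 1ℚ)) - X * (h + 1ℚ)            ≡.≡⟨ cong (λ u → (t + 1ℚ - ι 2 * X) * u - X * (h + 1ℚ)) st ⟩
      (t + 1ℚ - ι 2 * X) * (X * (h + h + 1ℚ)) - X * (h + 1ℚ)        ≡.≡⟨ lem₂ X h t ⟩
      -- The step equation is now used backwards, which removes the term quadratic in X and leaves
      -- the common factor X.
      X * ((h + h + 1ℚ) * t + h) - ι 2 * X * (X * (h + h + 1ℚ))     ≡.≡⟨ cong (λ u → X * ((h + h + 1ℚ) * t + h) - ι 2 * X * u) st ⟨
      X * ((h + h + 1ℚ) * t + h) - ι 2 * X * (t * (h + 1ℚ))         ≡.≡⟨ lem₃ X h t ⟩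
      X * (h - t)                                                   ≡.∎
      where module ≡ = ≡-Reasoning
    open ≤-Reasoning

-- Orbits of T that start at 2X.

module _ {X : ℚ} (1≤X : 1ℚ ≤ X) (s : ℕ → ℚ) (s₀≡ : s 0 ≡ X + X)
         (step : ∀ n → Step X (s n) (s (suc n))) where

  private
    0≤X : 0ℚ ≤ X
    0≤X = ≤-trans (nonNegative⁻¹ 1ℚ) 1≤X

  orbit≥X : ∀ n → X ≤ s n
  orbit≥X zero = subst (X ≤_) (sym s₀≡) (p≤p+q X 0≤X)
  orbit≥X (suc n) = step≥X 1≤X (≤-trans 0≤X (orbit≥X n)) (step n)

  orbit≤2X : ∀ n → s n ≤ X + X
  orbit≤2X zero = ≤-reflexive s₀≡
  orbit≤2X (suc n) = step≤2X 1≤X (≤-trans 0≤X (orbit≥X n)) (step n)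

  orbit≥2X-1 : ∀ n → X + X - 1ℚ ≤ s n
  orbit≥2X-1 zero = subst (X + X - 1ℚ ≤_) (sym s₀≡) (p+q≤p (X + X) (nonPositive⁻¹ (- 1ℚ)))
  orbit≥2X-1 (suc n) = step≥2X-1 1≤X (orbit≥X n) (step n)

  -- The whole orbit lies in [X, 2X], an interval of length X, and each step halves distances. Of
  -- the factor 2^N only N + 1 is kept, by N + 2 ≤ 2 (N + 1): a linear rate is all that
  -- `archimedean` requires.
  orbit-close : ∀ N m n → N ℕ.≤ m → N ℕ.≤ n → ι (suc N) * ∣ s m - s n ∣ ≤ X
  orbit-close zero m n _ _ = subst (_≤ X) (sym (*-identityˡ ∣ s m - s n ∣))
    (∣p-q∣≤-within (orbit≥X m) (orbit≤2X m) (orbit≥X n) (orbit≤2X n))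
  orbit-close (suc N) (suc m) (suc n) (ℕ.s≤s N≤m) (ℕ.s≤s N≤n) = begin
    ι (suc (suc N)) * d              ≡⟨ cong (_* d) (ι-homo-+ 1 (suc N)) ⟩
    (1ℚ + ι (suc N)) * d             ≤⟨ *-monoʳ-≤-nonNeg d {{∣-∣-nonNeg (s (suc m) - s (suc n))}}
                                          (+-monoˡ-≤ (ι (suc N)) (/1-mono-≤ {1ℤ} {ℤ.+ suc N} (ℤ.+≤+ (ℕ.s≤s ℕ.z≤n)))) ⟩
    (ι (suc N) + ι (suc N)) * d      ≡⟨ lem (ι (suc N)) d ⟩
    ι (suc N) * (d + d)              ≤⟨ *-monoˡ-≤-nonNeg (ι (suc N)) {{normalize-nonNeg (suc N) 1}}
                                          (step-contracts 1≤X {t = s (suc m)} {t′ = s (suc n)} (orbit≥X m) (orbit≥X n) (step m) (step n)) ⟩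
    ι (suc N) * ∣ s m - s n ∣        ≤⟨ orbit-close N m n N≤m N≤n ⟩
    X                                ∎
    where
    open ≤-Reasoning
    d = ∣ s (suc m) - s (suc n) ∣
    lem : ∀ a d → (a + a) * d ≡ a * (d + d)
    lem = solve 2 (λ a d → (a :+ a) :* d := a :* (d :+ d)) refl

-- Continued fractions that begin with a pair p, 1/p.

infixl 7 _*⁺_

_*⁺_ : ℚ⁺ → ℚ⁺ → ℚ⁺
(p , p>0) *⁺ (q , q>0) = p * q , pos*pos⇒pos p {{p>0}} q {{q>0}}

-- This is [p, 1/p, g], where g is the value of the remaining fraction.
block : ℚ⁺ → ℚ⁺ → ℚ⁺
block p g = p +⁺ 1/⁺ (1/⁺ p +⁺ 1/⁺ g)

1/⁺-inverseʳ : ∀ p → proj₁ p * proj₁ (1/⁺ p) ≡ 1ℚ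
1/⁺-inverseʳ (p , p>0) = *-inverseʳ p {{pos⇒nonZero p {{p>0}}}}

1/⁺-involutive : ∀ p → proj₁ (1/⁺ 1/⁺ p) ≡ proj₁ p
1/⁺-involutive p = begin
  r                                     ≡⟨ *-identityˡ r ⟨
  1ℚ * r                                ≡⟨ cong (_* r) (1/⁺-inverseʳ p) ⟨
  proj₁ p * proj₁ (1/⁺ p) * r           ≡⟨ *-assoc (proj₁ p) (proj₁ (1/⁺ p)) r ⟩
  proj₁ p * (proj₁ (1/⁺ p) * r)         ≡⟨ cong (proj₁ p *_) (1/⁺-inverseʳ (1/⁺ p)) ⟩
  proj₁ p * 1ℚ                          ≡⟨ *-identityʳ (proj₁ p) ⟩
  proj₁ p                               ∎
  where
  open ≡-Reasoning
  r = proj₁ (1/⁺ 1/⁺ p)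

-- Since 1 / (1/p + 1/g) = p g / (g + p), the block is p (2g + p) / (g + p).
block-value : ∀ p g → proj₁ (block p g) * (proj₁ g + proj₁ p) ≡ proj₁ p * (proj₁ g + proj₁ g + proj₁ p)
block-value p⁺ g⁺ = begin
  (p + v) * (g + p)                          ≡⟨ lem₁ p g v ⟩
  -- The two units become p · (1/p) and g · (1/g), so that p g (1/p + 1/g) v appears, where v is the
  -- inverse of the bracket.
  p * (g + p) + v * (g * 1ℚ + p * 1ℚ)        ≡⟨ cong₂ (λ i j → p * (g + p) + v * (g * i + p * j)) (1/⁺-inverseʳ p⁺) (1/⁺-inverseʳ g⁺) ⟨
  p * (g + p) + v * (g * (p * a) + p * (g * b)) ≡⟨ lem₂ p g a b v ⟩
  p * (g + p) + p * g * ((a + b) * v)        ≡⟨ cong (λ i → p * (g + p) + p * g * i) (1/⁺-inverseʳ (1/⁺ p⁺ +⁺ 1/⁺ g⁺)) ⟩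
  p * (g + p) + p * g * 1ℚ                   ≡⟨ lem₃ p g ⟩
  p * (g + g + p)                            ∎
  where
  open ≡-Reasoning
  p = proj₁ p⁺
  g = proj₁ g⁺
  a = proj₁ (1/⁺ p⁺)
  b = proj₁ (1/⁺ g⁺)
  v = proj₁ (1/⁺ (1/⁺ p⁺ +⁺ 1/⁺ g⁺))
  lem₁ : ∀ p g v → (p + v) * (g + p) ≡ p * (g + p) + v * (g * 1ℚ + p * 1ℚ)
  lem₁ = solve 3 (λ p g v → (p :+ v) :* (g :+ p) := p :* (g :+ p) :+ v :* (g :* con 1ℚ :+ p :* con 1ℚ)) refl
  lem₂ : ∀ p g a b v → p * (g + p) + v * (g * (p * a) + p * (g * b)) ≡ p * (g + p) + p * g * ((a + b) * v)
  lem₂ = solve 5 (λ p g a b v → p :* (g :+ p) :+ v :* (g :* (p :* a) :+ p :* (g :* b))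
    := p :* (g :+ p) :+ p :* g :* ((a :+ b) :* v)) refl
  lem₃ : ∀ p g → p * (g + p) + p * g * 1ℚ ≡ p * (g + g + p)
  lem₃ = solve 2 (λ p g → p :* (g :+ p) :+ p :* g :* con 1ℚ := p :* (g :+ g :+ p)) refl

-- For g = p h the value p (2g + p) / (g + p) loses a common factor p above and below. The step
-- equation therefore holds with p in the role of X, whatever power of x it is.
block-scaled : ∀ p g h → proj₁ g ≡ proj₁ p * h → Step (proj₁ p) h (proj₁ (block p g))
block-scaled p⁺@(p , p>0) g⁺ h g≡ = *-cancelʳ-≡-pos p {{p>0}} (begin
  G * (h + 1ℚ) * p               ≡⟨ lem₁ G h p ⟩
  G * (p * h + p)                ≡⟨ cong (λ g → G * (g + p)) g≡ ⟨
  G * (proj₁ g⁺ + p)             ≡⟨ block-value p⁺ g⁺ ⟩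
  p * (proj₁ g⁺ + proj₁ g⁺ + p)  ≡⟨ cong (λ g → p * (g + g + p)) g≡ ⟩
  p * (p * h + p * h + p)        ≡⟨ lem₂ h p ⟩
  p * (h + h + 1ℚ) * p           ∎)
  where
  open ≡-Reasoning
  G = proj₁ (block p⁺ g⁺)
  lem₁ : ∀ G h p → G * (h + 1ℚ) * p ≡ G * (p * h + p)
  lem₁ = solve 3 (λ G h p → G :* (h :+ con 1ℚ) :* p := G :* (p :* h :+ p)) refl
  lem₂ : ∀ h p → p * (p * h + p * h + p) ≡ p * (h + h + 1ℚ) * p
  lem₂ = solve 2 (λ h p → p :* (p :* h :+ p :* h :+ p) := p :* (h :+ h :+ con 1ℚ) :* p) refl

-- Absence of rational fixed points, and separation of positive roots.

close⇒≡ : ∀ {p q} → (∀ ε → 0ℚ < ε → ∣ p - q ∣ < ε) → p ≡ q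
close⇒≡ {p} {q} close = begin
  p                ≡⟨ lem p q ⟩
  (p - q) + q      ≡⟨ cong (_+ q) (∣p∣≡0⇒p≡0 (p - q) (≤-antisym ∣p-q∣≤0 (0≤∣p∣ (p - q)))) ⟩
  0ℚ + q           ≡⟨ +-identityˡ q ⟩
  q                ∎
  where
  open ≡-Reasoning
  ∣p-q∣≤0 : ∣ p - q ∣ ≤ 0ℚ
  ∣p-q∣≤0 = ≮⇒≥ λ 0<d → <-irrefl refl (close ∣ p - q ∣ 0<d)
  lem : ∀ a b → a ≡ (a - b) + b
  lem = solve 2 (λ a b → a := (a :- b) :+ b) refl

-- Adding a twice carries coprimality with a from b to 2a + b, which must then divide a + b; this is
-- impossible as a ≥ 1.
no-coprime-solution : ∀ x a b .{{_ : NonZero a}} → Coprime a b →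
  a ℕ.* (a ℕ.+ b) ≢ x ℕ.* b ℕ.* (a ℕ.+ (a ℕ.+ b))
no-coprime-solution x a@(suc _) b coprime eq =
  ℕₚ.m+n≮n _ (a ℕ.+ b) (∣⇒≤
    (coprime-divisor (coprime-+ {a ℕ.+ b} {a} (coprime-+ {b} {a} (Coprime.sym {a} {b} coprime)))
      (divides (x ℕ.* b) eq)))

-- The fixed-point equation q (q + 1) = x (2q + 1) is multiplied by b², and q b is replaced by a
-- throughout.
fixpoint-fraction : ∀ x a b q → q * ι b ≡ ι a → Step (ι x) q q →
  a ℕ.* (a ℕ.+ b) ≡ x ℕ.* b ℕ.* (a ℕ.+ (a ℕ.+ b))
fixpoint-fraction x a b q qB≡A st = ι-injective (begin
  ι (a ℕ.* (a ℕ.+ b))                      ≡⟨ ι-homo-* a (a ℕ.+ b) ⟩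
  A * ι (a ℕ.+ b)                          ≡⟨ cong (A *_) (ι-homo-+ a b) ⟩
  A * (A + B)                              ≡⟨ cong (λ A → A * (A + B)) qB≡A ⟨
  q * B * (q * B + B)                      ≡⟨ lem₁ q B ⟩
  q * (q + 1ℚ) * (B * B)                   ≡⟨ cong (_* (B * B)) st ⟩
  ι x * (q + q + 1ℚ) * (B * B)             ≡⟨ lem₂ (ι x) q B ⟩
  ι x * B * (q * B + (q * B + B))          ≡⟨ cong (λ A → ι x * B * (A + (A + B))) qB≡A ⟩
  ι x * B * (A + (A + B))                  ≡⟨ cong (λ C → ι x * B * (A + C)) (ι-homo-+ a b) ⟨
  ι x * B * (A + ι (a ℕ.+ b))              ≡⟨ cong₂ _*_ (ι-homo-* x b) (ι-homo-+ a (a ℕ.+ b)) ⟨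
  ι (x ℕ.* b) * ι (a ℕ.+ (a ℕ.+ b))        ≡⟨ ι-homo-* (x ℕ.* b) (a ℕ.+ (a ℕ.+ b)) ⟨
  ι (x ℕ.* b ℕ.* (a ℕ.+ (a ℕ.+ b)))        ∎)
  where
  open ≡-Reasoning
  A = ι a
  B = ι b
  lem₁ : ∀ q B → q * B * (q * B + B) ≡ q * (q + 1ℚ) * (B * B)
  lem₁ = solve 2 (λ q B → q :* B :* (q :* B :+ B) := q :* (q :+ con 1ℚ) :* (B :* B)) refl
  lem₂ : ∀ X q B → X * (q + q + 1ℚ) * (B * B) ≡ X * B * (q * B + (q * B + B))
  lem₂ = solve 3 (λ X q B → X :* (q :+ q :+ con 1ℚ) :* (B :* B) := X :* B :* (q :* B :+ (q :* B :+ B))) refl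

no-rational-fixpoint : ∀ x q → 0ℚ < q → ¬ Step (ι x) q q
no-rational-fixpoint x q@(mkℚ ℤ.+[1+ n ] d-1 c) 0<q st =
  -- Coprimality is stored irrelevantly in a rational and has to be recomputed before use.
  no-coprime-solution x (suc n) (suc d-1) (Coprime.recompute c)
    (fixpoint-fraction x (suc n) (suc d-1) q (p*↧p≡↥p q) st)
no-rational-fixpoint x (mkℚ ℤ.+0 _ _) (*<* (ℤ.+<+ ()))
no-rational-fixpoint x (mkℚ ℤ.-[1+ _ ] _ _) (*<* ())

-- In P(w) - P(z) = (w + z - (2X - 1))(w - z) the first factor is at least w, hence at least δ. Two
-- points with small values of P are therefore close.
poly-separates : ∀ {X δ w z} → 0ℚ < δ → δ ≤ w → X + X - 1ℚ ≤ z →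
  δ * ∣ w - z ∣ ≤ ∣ poly X w ∣ + ∣ poly X z ∣
poly-separates {X} {δ} {w} {z} 0<δ δ≤w 2X-1≤z = begin
  δ * ∣ w - z ∣                                ≤⟨ *-monoʳ-≤-nonNeg ∣ w - z ∣ {{∣-∣-nonNeg (w - z)}} δ≤m ⟩
  m * ∣ w - z ∣                                ≡⟨ cong (_* ∣ w - z ∣) (0≤p⇒∣p∣≡p (≤-trans (<⇒≤ 0<δ) δ≤m)) ⟨
  ∣ m ∣ * ∣ w - z ∣                            ≡⟨ ∣p*q∣≡∣p∣*∣q∣ m (w - z) ⟨
  ∣ m * (w - z) ∣                              ≡⟨ cong ∣_∣ (lem X w z) ⟨
  ∣ poly X w - poly X z ∣                      ≤⟨ ∣p-q∣≤∣p∣+∣q∣ (poly X w) (poly X z) ⟩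
  ∣ poly X w ∣ + ∣ poly X z ∣                  ∎
  where
  open ≤-Reasoning
  m = w + (z - (X + X - 1ℚ))
  δ≤m : δ ≤ m
  δ≤m = ≤-trans δ≤w (p≤p+q w (0≤q-p 2X-1≤z))
  lem : ∀ X w z → poly X w - poly X z ≡ (w + (z - (X + X - 1ℚ))) * (w - z)
  lem = solve 3 (λ X w z →
    (w :* w :- (con (ι 2) :* X :- con (ι 1)) :* w :- X) :- (z :* z :- (con (ι 2) :* X :- con (ι 1)) :* z :- X)
    := (w :+ (z :- (X :+ X :- con 1ℚ))) :* (w :- z)) refl

-- The continued fraction as an iterate of T.

module _ (x : ℕ) .{{x≢0 : NonZero x}} where

  x⁺ : ℚ⁺
  x⁺ = ι x , normalize-pos x 1

  T : ℚ⁺ → ℚ⁺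
  T h = block x⁺ (x⁺ *⁺ h)

  T-step : ∀ h → Step (ι x) (proj₁ h) (proj₁ (T h))
  T-step h = block-scaled x⁺ (x⁺ *⁺ h) (proj₁ h) refl

  -- The start 2x is [x, 1/x], so index k corresponds to the fraction with k + 1 pairs.
  iterate : ℕ → ℚ⁺
  iterate zero    = x⁺ +⁺ x⁺
  iterate (suc k) = T (iterate k)

  fraction : List⁺ ℕ → ℚ⁺
  fraction = continuedFraction ∘ List⁺.concatMap (λ i → power⁺ x i ∷ 1/⁺ power⁺ x i ∷ [])

  power⁺-suc : ∀ e → proj₁ (power⁺ x (suc e)) ≡ ι x * ι (x ℕ.^ e)
  power⁺-suc e = ι-homo-* x (x ℕ.^ e)

  -- Induction on k with e free: removing the first pair leaves a fraction whose exponents start one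
  -- higher. The exponents enter through equations because `applyUpTo` replaces `f` by `f ∘ suc`,
  -- whose values match the required form only propositionally.
  fraction-scaled : ∀ k e i f → i ≡ suc e → (∀ j → f j ≡ suc (suc (e ℕ.+ j))) →
    proj₁ (fraction (i ∷ applyUpTo f k)) ≡ ι (x ℕ.^ e) * proj₁ (iterate k)
  fraction-scaled zero e i f refl f≡ = begin
    p + proj₁ (1/⁺ 1/⁺ p⁺)                   ≡⟨ cong (p +_) (1/⁺-involutive p⁺) ⟩
    p + p                                    ≡⟨ cong₂ _+_ (power⁺-suc e) (power⁺-suc e) ⟩
    ι x * ι (x ℕ.^ e) + ι x * ι (x ℕ.^ e)    ≡⟨ lem (ι x) (ι (x ℕ.^ e)) ⟩
    ι (x ℕ.^ e) * (ι x + ι x)                ∎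
    where
    open ≡-Reasoning
    p⁺ = power⁺ x (suc e)
    p = proj₁ p⁺
    lem : ∀ a b → a * b + a * b ≡ b * (a + a)
    lem = solve 2 (λ a b → a :* b :+ a :* b := b :* (a :+ a)) refl
  fraction-scaled (suc k) e i f refl f≡ = *-cancelʳ-≡-pos (h + 1ℚ) {{+1-pos (<⇒≤ 0<h)}} (begin
    -- Both sides of the claim agree after multiplication by h + 1: one by the block equation for
    -- x^(e+1), the other by x^e times that for x.
    proj₁ (block p⁺ g⁺) * (h + 1ℚ)           ≡⟨ block-scaled p⁺ g⁺ h tail≡ ⟩
    p * (h + h + 1ℚ)                         ≡⟨ cong (_* (h + h + 1ℚ)) (power⁺-suc e) ⟩
    ι x * ι (x ℕ.^ e) * (h + h + 1ℚ)         ≡⟨ lem (ι x) (ι (x ℕ.^ e)) (h + h + 1ℚ) ⟩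
    ι (x ℕ.^ e) * (ι x * (h + h + 1ℚ))       ≡⟨ cong (ι (x ℕ.^ e) *_) (T-step (iterate k)) ⟨
    ι (x ℕ.^ e) * (t * (h + 1ℚ))             ≡⟨ *-assoc (ι (x ℕ.^ e)) t (h + 1ℚ) ⟨
    ι (x ℕ.^ e) * t * (h + 1ℚ)               ∎)
    where
    open ≡-Reasoning
    p⁺ = power⁺ x (suc e)
    p = proj₁ p⁺
    h = proj₁ (iterate k)
    t = proj₁ (iterate (suc k))
    0<h : 0ℚ < h
    0<h = positive⁻¹ h {{proj₂ (iterate k)}}
    g⁺ = fraction (f 0 ∷ applyUpTo (f ∘ suc) k)
    -- The factor pulled out of the tail is x^(e+1), which is `p` itself.
    tail≡ : proj₁ g⁺ ≡ p * h
    tail≡ = fraction-scaled k (suc e) (f 0) (f ∘ suc)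
      (trans (f≡ 0) (cong (suc ∘ suc) (ℕₚ.+-identityʳ e)))
      (λ j → trans (f≡ (suc j)) (cong (suc ∘ suc) (ℕₚ.+-suc e j)))
    lem : ∀ a b c → a * b * c ≡ b * (a * c)
    lem = solve 3 (λ a b c → a :* b :* c := b :* (a :* c)) refl

  F≡iterate : ∀ k → proj₁ (F (suc k) x) ≡ proj₁ (iterate k)
  F≡iterate k = trans (fraction-scaled k 0 1 (2 ℕ.+_) refl (λ _ → refl)) (*-identityˡ (proj₁ (iterate k)))

-- The limit of the orbit: convergence, root, uniqueness, irrationality.

module _ (x : ℕ) .{{_ : NonZero x}} (s : ℕ → ℚ) (s₀≡ : s 0 ≡ ι x + ι x)
         (s-step : ∀ n → Step (ι x) (s n) (s (suc n))) where

  private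
    X : ℚ
    X = ι x

    1≤X : 1ℚ ≤ X
    1≤X = /1-mono-≤ {1ℤ} {ℤ.+ x} (ℤ.+≤+ (ℕ.>-nonZero⁻¹ x))

    0<X : 0ℚ < X
    0<X = <-≤-trans (positive⁻¹ 1ℚ) 1≤X

    s≥X : ∀ n → X ≤ s n
    s≥X = orbit≥X 1≤X s s₀≡ s-step

  orbit-cauchy : IsCauchy s
  orbit-cauchy ε 0<ε = let N , x<Nε = archimedean x 0<ε in
    N , λ m n N≤m N≤n → *-cancelˡ-<-nonNeg (ι (suc N)) {{normalize-nonNeg (suc N) 1}}
        (≤-<-trans (orbit-close 1≤X s s₀≡ s-step N m n N≤m N≤n) x<Nε)

  limit : ℝ
  limit = mkℝ s orbit-cauchy

  converges : ∀ u → (∀ n → u n ≡ s n) → ConvergesTo (fromℚ ∘ u) limit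
  converges u u≡s ε (δ , 0<δ , M , δ≤ε) = let N , close = orbit-cauchy (½ * δ) (½-pos 0<δ) in
    -- One half of δ bounds the distance to the limit; the other half is the uniform gap that `_<ℝ_`
    -- demands.
    N , λ n N≤n → ½ * δ , ½-pos 0<δ , M ℕ.⊔ N , λ m h → begin
      ∣ u n - s m ∣ + ½ * δ                    ≡⟨ cong (λ p → ∣ p - s m ∣ + ½ * δ) (u≡s n) ⟩
      ∣ s n - s m ∣ + ½ * δ                    ≤⟨ +-monoˡ-≤ (½ * δ) (<⇒≤ (close n m N≤n (ℕₚ.m⊔n≤o⇒n≤o M N h))) ⟩
      ½ * δ + ½ * δ                            ≡⟨ ½p+½p≡p δ ⟩
      δ                                        ≡⟨ +-identityˡ δ ⟨
      0ℚ + δ                                   ≤⟨ δ≤ε m (ℕₚ.m⊔n≤o⇒m≤o M N h) ⟩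
      seq ε m                                  ∎
    where open ≤-Reasoning

  limit-positive : fromℕ 0 <ℝ limit
  limit-positive = X , 0<X , 0 , λ n _ → subst (_≤ s n) (sym (+-identityˡ X)) (s≥X n)

  poly-limit : ∀ ε → 0ℚ < ε → ∃[ N ] ∀ n → N ℕ.≤ n → ∣ poly X (s n) ∣ < ε
  poly-limit ε 0<ε = let N , close = orbit-cauchy ε 0<ε in
    -- The bound on P at a term involves its predecessor, so the index is shifted by one.
    suc N , λ { (suc n) (ℕ.s≤s N≤n) → ≤-<-trans
        (∣poly∣≤step 1≤X (s≥X n) (s-step n))
        (close n (suc n) N≤n (ℕₚ.m≤n⇒m≤1+n N≤n)) }

  limit-root : P x limit ≈ℝ fromℕ 0
  limit-root ε 0<ε = let N , small = poly-limit ε 0<ε in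
    N , λ n N≤n → subst (λ p → ∣ p ∣ < ε) (sym (+-identityʳ (poly X (s n)))) (small n N≤n)

  limit-unique : ∀ w → fromℕ 0 <ℝ w → P x w ≈ℝ fromℕ 0 → w ≈ℝ limit
  limit-unique w (δ , 0<δ , K , δ≤w) Pw≈0 ε 0<ε =
    -- Two tolerances of δ ε / 2 add up to δ ε, from which the factor δ of `poly-separates` cancels.
    let M , hw = Pw≈0 (½ * (δ * ε)) (½-pos (*-pos 0<δ 0<ε))
        N , hs = poly-limit (½ * (δ * ε)) (½-pos (*-pos 0<δ 0<ε))
    in K ℕ.⊔ (M ℕ.⊔ N) , λ n h →
      let h′ = ℕₚ.m⊔n≤o⇒n≤o K (M ℕ.⊔ N) h in
      *-cancelˡ-<-nonNeg δ {{nonNegative (<⇒≤ 0<δ)}} (begin-strict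
        δ * ∣ seq w n - s n ∣                            ≤⟨ poly-separates 0<δ
          (subst (_≤ seq w n) (+-identityˡ δ) (δ≤w n (ℕₚ.m⊔n≤o⇒m≤o K (M ℕ.⊔ N) h)))
          (orbit≥2X-1 1≤X s s₀≡ s-step n) ⟩
        ∣ poly X (seq w n) ∣ + ∣ poly X (s n) ∣          <⟨ +-mono-<
          (subst (λ p → ∣ p ∣ < ½ * (δ * ε)) (+-identityʳ (poly X (seq w n))) (hw n (ℕₚ.m⊔n≤o⇒m≤o M N h′)))
          (hs n (ℕₚ.m⊔n≤o⇒n≤o M N h′)) ⟩
        ½ * (δ * ε) + ½ * (δ * ε)                        ≡⟨ ½p+½p≡p (δ * ε) ⟩
        δ * ε                                            ∎)
    where open ≤-Reasoning

  -- If the limit were a rational q, the contraction would make the shifted orbit tend to T q as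
  -- well as to q, so q would be a rational fixed point.
  limit-irrational : Irrational limit
  limit-irrational (q , z≈q) = no-rational-fixpoint x q 0<q
    (subst (λ t → t * (q + 1ℚ) ≡ X * (q + q + 1ℚ)) (sym q≡t) (T-step x q⁺))
    where
    open ≤-Reasoning
    -- A rational q below X would stay at distance at least X - q from every term.
    X≤q : X ≤ q
    X≤q = ≮⇒≥ λ q<X →
      let 0<X-q = subst (_< X - q) (+-inverseʳ q) (+-monoˡ-< (- q) q<X)
          N , close = z≈q (X - q) 0<X-q
          q≤sN = ≤-trans (<⇒≤ q<X) (s≥X N)
      in <-irrefl refl (begin-strict
        X - q              ≤⟨ +-monoˡ-≤ (- q) (s≥X N) ⟩
        s N - q            ≡⟨ 0≤p⇒∣p∣≡p (0≤q-p q≤sN) ⟨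
        ∣ s N - q ∣        <⟨ close N ℕₚ.≤-refl ⟩
        X - q              ∎)
    0<q : 0ℚ < q
    0<q = <-≤-trans 0<X X≤q
    q⁺ : ℚ⁺
    q⁺ = q , positive 0<q
    t : ℚ
    t = proj₁ (T x q⁺)
    q≡t : q ≡ t
    q≡t = close⇒≡ λ ε 0<ε →
      let N , close = z≈q (½ * ε) (½-pos 0<ε) in begin-strict
      ∣ q - t ∣                                    ≤⟨ ∣p-r∣≤ q (s (suc N)) t ⟩
      -- The second distance is doubled only to match the form of `step-contracts`.
      ∣ q - s (suc N) ∣ + ∣ s (suc N) - t ∣        ≤⟨ +-monoʳ-≤ ∣ q - s (suc N) ∣ (p≤p+q ∣ s (suc N) - t ∣ (0≤∣p∣ (s (suc N) - t))) ⟩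
      ∣ q - s (suc N) ∣ + (∣ s (suc N) - t ∣ + ∣ s (suc N) - t ∣)
                                                   ≤⟨ +-monoʳ-≤ ∣ q - s (suc N) ∣
                                                        (step-contracts 1≤X {t = s (suc N)} {t′ = t} (s≥X N) X≤q (s-step N) (T-step x q⁺)) ⟩
      ∣ q - s (suc N) ∣ + ∣ s N - q ∣              ≡⟨ cong (_+ ∣ s N - q ∣) (∣p-q∣-comm q (s (suc N))) ⟩
      ∣ s (suc N) - q ∣ + ∣ s N - q ∣              <⟨ +-mono-< (close (suc N) (ℕₚ.n≤1+n N)) (close N ℕₚ.≤-refl) ⟩
      ½ * ε + ½ * ε                                ≡⟨ ½p+½p≡p ε ⟩
      ε                                            ∎

  limit-quadratic : QuadraticIrrational limit
  -- The witnesses are the coefficients 1, 1 - 2x and -x of P.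
  limit-quadratic = limit-irrational , 1ℤ , 1ℤ ℤ.- ℤ.+ 2 ℤ.* ℤ.+ x , ℤ.- ℤ.+ x , (λ ()) ,
    λ ε 0<ε → let N , small = poly-limit ε 0<ε in
      N , λ n N≤n → subst (λ p → ∣ p ∣ < ε) (sym (value (s n))) (small n N≤n)
    where
    open ≡-Reasoning
    b≡ : (1ℤ ℤ.- ℤ.+ 2 ℤ.* ℤ.+ x) / 1 ≡ 1ℚ - ι 2 * X
    b≡ = begin
      (1ℤ ℤ.- ℤ.+ 2 ℤ.* ℤ.+ x) / 1         ≡⟨ /1-homo-+ 1ℤ (ℤ.- (ℤ.+ 2 ℤ.* ℤ.+ x)) ⟩
      1ℚ + (ℤ.- (ℤ.+ 2 ℤ.* ℤ.+ x)) / 1     ≡⟨ cong (1ℚ +_) (/1-homo‿- (ℤ.+ 2 ℤ.* ℤ.+ x)) ⟩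
      1ℚ - (ℤ.+ 2 ℤ.* ℤ.+ x) / 1           ≡⟨ cong (λ p → 1ℚ - p) (/1-homo-* (ℤ.+ 2) (ℤ.+ x)) ⟩
      1ℚ - ι 2 * X                         ∎
    lem : ∀ X z → 1ℚ * (z * z) + (1ℚ - ι 2 * X) * z + - X - 0ℚ ≡ poly X z
    lem = solve 2 (λ X z → con 1ℚ :* (z :* z) :+ (con 1ℚ :- con (ι 2) :* X) :* z :+ :- X :- con 0ℚ
      := z :* z :- (con (ι 2) :* X :- con (ι 1)) :* z :- X) refl
    value : ∀ z → 1ℚ * (z * z) + (1ℤ ℤ.- ℤ.+ 2 ℤ.* ℤ.+ x) / 1 * z + (ℤ.- ℤ.+ x) / 1 - 0ℚ ≡ poly X z
    value z = trans
      (cong₂ (λ b c → 1ℚ * (z * z) + b * z + c - 0ℚ) b≡ (/1-homo‿- (ℤ.+ x)))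
      (lem X z)

theorem12 : (x : ℕ) .{{_ : NonZero x}} →
    ∃[ z ] ( ConvergesTo (λ k → fromℚ (proj₁ (F (suc k) x))) z
    × QuadraticIrrational z
    × fromℕ 0 <ℝ z
    × P x z ≈ℝ fromℕ 0
    × (∀ w → fromℕ 0 <ℝ w → P x w ≈ℝ fromℕ 0 → w ≈ℝ z) )
theorem12 x =
  limit x s refl step
  , converges x s refl step (λ k → proj₁ (F (suc k) x)) (F≡iterate x)
  , limit-quadratic x s refl step
  , limit-positive x s refl step
  , limit-root x s refl step
  , limit-unique x s refl step
  where
  s : ℕ → ℚ
  s = proj₁ ∘ iterate x
  step : ∀ n → Step (ι x) (s n) (s (suc n))
  step n = T-step x (iterate x n)
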